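{- Let $T \in \mathbb{F}^{n} \otimes \mathbb{F}^n \otimes\mathbb{F}^n$ be symmetric and concise. Then $\lim_{m\to\infty} Q(T^{\boxtimes m})^{1/m} \geq \sqrt{n}$.
   Context: $\mathbb{F}$ is any field. $T=\sum T_{i,j,k}e_i\otimes e_j\otimes e_k$ is symmetric if $T_{i_1,i_2,i_3}=T_{i_{\sigma(1)},i_{\sigma(2)},i_{\sigma(3)}}$ for all indices and all $\sigma\in S_3$. $T$ is concise if each of its three flattenings (grouping two tensor legs) has rank $n$. The subrank $Q(T)$ is the largest $r$ such that there are linear maps $L_i:\mathbb{F}^{n}\to\mathbb{F}^r$ with $(L_1\otimes L_2\otimes L_3)T=\sum_{i=1}^r e_i\otimes e_i\otimes e_i$; $\boxtimes$ denotes the Kronecker product, and $\lim_{m\to\infty} Q(T^{\boxtimes m})^{1/m}$ is the asymptotic subrank. -}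

module Defs where

open import Level using (Level; _⊔_)
open import Algebra.Bundles using (CommutativeRing)
open import Data.Nat as ℕ using (ℕ; zero; suc; _^_)
open import Data.Fin using (Fin; remQuot; _≟_)
open import Data.Product using (Σ; _×_; _,_; proj₁; proj₂; ∃-syntax)
open import Relation.Nullary using (¬_; yes; no)

module _ {c ℓ : Level} (R : CommutativeRing c ℓ) where
  open CommutativeRing R

  record IsField : Set (c ⊔ ℓ) where
    field
      nontrivial : ¬ (0# ≈ 1#)
      inverse    : ∀ x → ¬ (x ≈ 0#) → ∃[ y ] (x * y ≈ 1#)

  ∑ : ∀ {n} → (Fin n → Carrier) → Carrier
  ∑ {zero}  f = 0#
  ∑ {suc n} f = f Fin.zero + ∑ (λ i → f (Fin.suc i))

  -- tensors in F^n ⊗ F^n ⊗ F^n, given by coordinates in the standard basis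
  Tensor : ℕ → Set c
  Tensor n = Fin n → Fin n → Fin n → Carrier

  Symmetric : ∀ {n} → Tensor n → Set ℓ
  Symmetric T = ∀ i j k →
      (T i j k ≈ T i k j) × (T i j k ≈ T j i k) × (T i j k ≈ T j k i)
    × (T i j k ≈ T k i j) × (T i j k ≈ T k j i)

  FullRowRank : ∀ {n m} → (Fin n → Fin m → Carrier) → Set (c ⊔ ℓ)
  FullRowRank {n} {m} M =
    ∀ (λ' : Fin n → Carrier) → (∀ col → ∑ (λ i → λ' i * M i col) ≈ 0#) → ∀ i → λ' i ≈ 0#

  -- flattenings F^n → F^n ⊗ F^n, rows indexed by the ungrouped leg,
  -- columns indexed by pairs of the other two legs (pair index via Fin (n * n))
  flat₁ flat₂ flat₃ : ∀ {n} → Tensor n → Fin n → Fin (n ℕ.* n) → Carrier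
  flat₁ {n} T i p = T i (proj₁ (remQuot {n} n p)) (proj₂ (remQuot {n} n p))
  flat₂ {n} T j p = T (proj₁ (remQuot {n} n p)) j (proj₂ (remQuot {n} n p))
  flat₃ {n} T k p = T (proj₁ (remQuot {n} n p)) (proj₂ (remQuot {n} n p)) k

  Concise : ∀ {n} → Tensor n → Set (c ⊔ ℓ)
  Concise T = FullRowRank (flat₁ T) × FullRowRank (flat₂ T) × FullRowRank (flat₃ T)

  unitTensor : (r : ℕ) → Tensor r
  unitTensor r a b d with a ≟ b | b ≟ d
  ... | yes _ | yes _ = 1#
  ... | _     | _     = 0#

  -- Kronecker product; index of F^a ⊗ F^b is Fin (a * b), (i , i') ↦ combine i i'
  kron : ∀ {a b} → Tensor a → Tensor b → Tensor (a ℕ.* b)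
  kron {a} {b} S T i j k =
    S (proj₁ (remQuot {a} b i)) (proj₁ (remQuot {a} b j)) (proj₁ (remQuot {a} b k))
    * T (proj₂ (remQuot {a} b i)) (proj₂ (remQuot {a} b j)) (proj₂ (remQuot {a} b k))

  kronPow : ∀ {n} → (m : ℕ) → Tensor n → Tensor (n ^ m)
  kronPow zero    T = unitTensor 1
  kronPow (suc m) T = kron T (kronPow m T)

  -- linear map F^n → F^r as an r × n matrix
  LinMap : ℕ → ℕ → Set c
  LinMap n r = Fin r → Fin n → Carrier

  apply3 : ∀ {n r} → LinMap n r → LinMap n r → LinMap n r → Tensor n → Tensor r
  apply3 L₁ L₂ L₃ T a b d =
    ∑ (λ i → ∑ (λ j → ∑ (λ k → L₁ a i * L₂ b j * L₃ d k * T i j k)))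

  RestrictsToUnit : ∀ {n} → Tensor n → ℕ → Set (c ⊔ ℓ)
  RestrictsToUnit {n} T r =
    Σ (LinMap n r) λ L₁ → Σ (LinMap n r) λ L₂ → Σ (LinMap n r) λ L₃ →
      ∀ a b d → apply3 L₁ L₂ L₃ T a b d ≈ unitTensor r a b d

  IsSubrank : ∀ {n} → Tensor n → ℕ → Set (c ⊔ ℓ)
  IsSubrank T r = RestrictsToUnit T r × (∀ r' → RestrictsToUnit T r' → r' ℕ.≤ r)

{-# OPTIONS --safe #-}
module Submission where

-- Row-reduce the first flattening of T: this changes the basis of the first leg so that the i-th
-- slice has its lexicographically first nonzero entry, a 1, at (xᵢ , yᵢ), with distinct pivots.
-- Restrict T ⊠ T to the index (i , i) on leg 1, (xⱼ , yⱼ) on leg 2 and (yₖ , xₖ) on leg 3. By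
-- symmetry the entries are T′ᵢ(xⱼ , yₖ) T′ᵢ(xₖ , yⱼ). With wᵢ = n xᵢ + yᵢ the two positions have
-- total weight wⱼ + wₖ, so a nonzero entry needs 2 wᵢ ≤ wⱼ + wₖ, with equality only for i = j = k,
-- where the entry is 1. In the q-th power, the words of any one fixed total weight therefore
-- span a unit tensor, and by pigeonhole some weight is attained by at least n^q / (q n² + 1)
-- words. So Q(T^⊠2q) ≥ n^q / (q n² + 1), and the denominator is lost in the exponential growth.
-- Equality in F is undecidable, so row reduction is done under a double negation, which is
-- harmless because the final inequality between naturals is decidable.

open import Defs
open import Algebra.Bundles using (CommutativeRing)
open import Data.Nat using (ℕ; _*_; _^_; _≤_; _<_)
open import Data.Product using (∃-syntax)

open import Level using (Level; _⊔_)
open import Function using (_∘_; id)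
open import Function.Definitions using (Injective)
open import Data.Nat using (zero; suc; _+_; z≤n; s≤s; s≤s⁻¹; _≤?_; NonZero; >-nonZero; >-nonZero⁻¹)
import Data.Nat.Properties as ℕₚ
open import Data.Nat.Tactic.RingSolver using (solve-∀)
open import Data.Fin using (Fin; zero; suc; toℕ; _≟_; _↑ˡ_; _↑ʳ_; combine; remQuot; punchIn)
import Data.Fin.Properties as Finₚ
open import Data.Product using (Σ; _×_; _,_; proj₁; proj₂; ∃₂; uncurry)
open import Data.Sum using (_⊎_; inj₁; inj₂)
open import Data.Vec.Functional using (_∷_; insertAt)
open import Data.Vec.Functional.Properties using (insertAt-lookup; insertAt-punchIn)
open import Relation.Nullary using (¬_; yes; no; contradiction)
open import Relation.Nullary.Decidable using (decidable-stable; ¬¬-excluded-middle)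
open import Relation.Nullary.Negation using (¬¬-map)
open import Relation.Unary using (Decidable)
open import Relation.Binary.PropositionalEquality as ≡ using (_≡_)

-- Arithmetic

-- Bernoulli's inequality `(1 + 1/u)^q ≥ 1 + q/u`, cleared of denominators.
bernoulli : ∀ u q → u ^ q * (u + q) ≤ u * (u + 1) ^ q
bernoulli u zero = ℕₚ.≤-reflexive (lemma u)
  where lemma : ∀ u → 1 * (u + 0) ≡ u * 1
        lemma = solve-∀
bernoulli u (suc q) = begin
  u * u ^ q * (u + suc q)                     ≡⟨ lemma₁ u q (u ^ q) ⟩
  u * (u ^ q * (u + q)) + u ^ q * u           ≤⟨ ℕₚ.+-monoʳ-≤ _ (ℕₚ.*-monoʳ-≤ (u ^ q) (ℕₚ.m≤m+n u q)) ⟩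
  u * (u ^ q * (u + q)) + u ^ q * (u + q)     ≡⟨ lemma₂ u (u ^ q * (u + q)) ⟩
  (u + 1) * (u ^ q * (u + q))                 ≤⟨ ℕₚ.*-monoʳ-≤ (u + 1) (bernoulli u q) ⟩
  (u + 1) * (u * (u + 1) ^ q)                 ≡⟨ lemma₃ u ((u + 1) ^ q) ⟩
  u * ((u + 1) * (u + 1) ^ q)                 ∎
  where
  open ℕₚ.≤-Reasoning
  lemma₁ : ∀ u q v → u * v * (u + (1 + q)) ≡ u * (v * (u + q)) + v * u
  lemma₁ = solve-∀
  lemma₂ : ∀ u v → u * v + v ≡ (u + 1) * v
  lemma₂ = solve-∀
  lemma₃ : ∀ u v → (u + 1) * (u * v) ≡ u * ((u + 1) * v)
  lemma₃ = solve-∀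

-- The second-order version `(1 + 1/u)^q ≥ q²/(2u²)`: quadratic growth is what absorbs a loss linear
-- in `q`. In the induction the increment `1 + 2q` of `q²` is paid for by `bernoulli`.
bernoulli² : ∀ u .{{_ : NonZero u}} q → q * q * u ^ q ≤ 2 * (u * u) * (u + 1) ^ q
bernoulli² u zero = z≤n
bernoulli² u (suc q) = begin
  (1 + q) * (1 + q) * (u * v)                         ≡⟨ lemma₁ u q v ⟩
  u * (q * q * v) + u * (v * (1 + 2 * q))             ≤⟨ ℕₚ.+-mono-≤ (ℕₚ.*-monoʳ-≤ u (bernoulli² u q))
                                                            (ℕₚ.*-monoʳ-≤ u (ℕₚ.*-monoʳ-≤ v 1+2q≤2[u+q])) ⟩
  u * (2 * (u * u) * w) + u * (v * (2 * (u + q)))     ≡⟨ ≡.cong (u * (2 * (u * u) * w) +_) (lemma₂ u q v) ⟩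
  u * (2 * (u * u) * w) + 2 * u * (v * (u + q))       ≤⟨ ℕₚ.+-monoʳ-≤ (u * (2 * (u * u) * w)) (ℕₚ.*-monoʳ-≤ (2 * u) (bernoulli u q)) ⟩
  u * (2 * (u * u) * w) + 2 * u * (u * w)             ≡⟨ lemma₃ u w ⟩
  2 * (u * u) * ((u + 1) * w)                         ∎
  where
  open ℕₚ.≤-Reasoning
  v = u ^ q
  w = (u + 1) ^ q
  1+2q≤2[u+q] : 1 + 2 * q ≤ 2 * (u + q)
  1+2q≤2[u+q] = begin
    1 + 2 * q      ≤⟨ ℕₚ.+-monoˡ-≤ (2 * q) (>-nonZero⁻¹ u) ⟩
    u + 2 * q      ≤⟨ ℕₚ.+-monoˡ-≤ (2 * q) (ℕₚ.m≤n*m u 2) ⟩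
    2 * u + 2 * q  ≡⟨ ℕₚ.*-distribˡ-+ 2 u q ⟨
    2 * (u + q)    ∎
  lemma₁ : ∀ u q v → (1 + q) * (1 + q) * (u * v) ≡ u * (q * q * v) + u * (v * (1 + 2 * q))
  lemma₁ = solve-∀
  lemma₂ : ∀ u q v → u * (v * (2 * (u + q))) ≡ 2 * u * (v * (u + q))
  lemma₂ = solve-∀
  lemma₃ : ∀ u w → u * (2 * (u * u) * w) + 2 * u * (u * w) ≡ 2 * (u * u) * ((u + 1) * w)
  lemma₃ = solve-∀

-- One of the two factors `q` in `bernoulli²` is traded for `2u²d`, and `2u²` then cancels.
exponential-beats-linear : ∀ u .{{_ : NonZero u}} d q → 2 * (u * u) * d ≤ q →
                           q * d * u ^ q ≤ (u + 1) ^ q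
exponential-beats-linear u@(suc _) d q h = ℕₚ.*-cancelˡ-≤ (2 * (u * u)) (begin
  2 * (u * u) * (q * d * u ^ q)    ≡⟨ lemma (2 * (u * u)) q d (u ^ q) ⟩
  q * (2 * (u * u) * d) * u ^ q    ≤⟨ ℕₚ.*-monoˡ-≤ (u ^ q) (ℕₚ.*-monoʳ-≤ q h) ⟩
  q * q * u ^ q                    ≤⟨ bernoulli² u q ⟩
  2 * (u * u) * (u + 1) ^ q        ∎)
  where
  open ℕₚ.≤-Reasoning
  lemma : ∀ t q d v → t * (q * d * v) ≡ q * (t * d) * v
  lemma = solve-∀

^-doubling : ∀ a q → (a * a) ^ q ≡ a ^ (q * 2)
^-doubling a q = ≡.trans (≡.cong (_^ q) (≡.cong (a *_) (≡.sym (ℕₚ.*-identityʳ a))))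
                 (≡.trans (ℕₚ.^-*-assoc a 2 q) (≡.cong (a ^_) (ℕₚ.*-comm 2 q)))

^-distribʳ-* : ∀ q a b → (a * b) ^ q ≡ a ^ q * b ^ q
^-distribʳ-* zero    a b = ≡.refl
^-distribʳ-* (suc q) a b = ≡.trans (≡.cong (a * b *_) (^-distribʳ-* q a b)) (lemma a b (a ^ q) (b ^ q))
  where lemma : ∀ a b v w → a * b * (v * w) ≡ a * v * (b * w)
        lemma = solve-∀

-- The integer gap `a² + 1 ≤ n b²` gives a growth rate `(1 + 1/a²)^q`, which swallows both the
-- pigeonhole loss `q n² + 1` and a spare factor `a`, kept for odd exponents.
power-bound : ∀ a .{{_ : NonZero a}} b n q s → a * a < n * (b * b) →
              2 * (a * a * (a * a)) * ((n * n + 1) * a) ≤ q → 1 ≤ q →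
              n ^ q ≤ s * (q * (n * n) + 1) → a * a ^ (q * 2) ≤ s * b ^ (q * 2)
power-bound a@(suc _) b n q s a²<nb² large 1≤q size =
  ℕₚ.*-cancelˡ-≤ K {{>-nonZero (ℕₚ.m≤n+m 1 (q * (n * n)))}} (begin
  K * (a * a ^ (q * 2))                  ≡⟨ ≡.cong (λ t → K * (a * t)) (≡.sym (^-doubling a q)) ⟩
  K * (a * (a * a) ^ q)                  ≤⟨ ℕₚ.*-monoˡ-≤ (a * (a * a) ^ q) K≤ ⟩
  q * (n * n + 1) * (a * (a * a) ^ q)    ≡⟨ lemma₁ q (n * n + 1) a ((a * a) ^ q) ⟩
  q * ((n * n + 1) * a) * (a * a) ^ q    ≤⟨ exponential-beats-linear (a * a) ((n * n + 1) * a) q large ⟩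
  (a * a + 1) ^ q                        ≤⟨ ℕₚ.^-monoˡ-≤ q (≡.subst (_≤ n * (b * b)) (ℕₚ.+-comm 1 (a * a)) a²<nb²) ⟩
  (n * (b * b)) ^ q                      ≡⟨ ^-distribʳ-* q n (b * b) ⟩
  n ^ q * (b * b) ^ q                    ≤⟨ ℕₚ.*-monoˡ-≤ ((b * b) ^ q) size ⟩
  s * K * (b * b) ^ q                    ≡⟨ ≡.cong (s * K *_) (^-doubling b q) ⟩
  s * K * b ^ (q * 2)                    ≡⟨ lemma₂ s K (b ^ (q * 2)) ⟩
  K * (s * b ^ (q * 2))                  ∎)
  where
  open ℕₚ.≤-Reasoning
  K = q * (n * n) + 1
  K≤ : K ≤ q * (n * n + 1)
  K≤ = ≡.subst (K ≤_) (≡.sym (lemma q (n * n))) (ℕₚ.+-monoʳ-≤ (q * (n * n)) 1≤q)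
    where lemma : ∀ q t → q * (t + 1) ≡ q * t + q
          lemma = solve-∀
  lemma₁ : ∀ q t a v → q * t * (a * v) ≡ q * (t * a) * v
  lemma₁ = solve-∀
  lemma₂ : ∀ s k v → s * k * v ≡ k * (s * v)
  lemma₂ = solve-∀

data Parity : ℕ → Set where
  even : ∀ q → Parity (q * 2)
  odd  : ∀ q → Parity (suc (q * 2))

parity : ∀ m → Parity m
parity zero = even 0
parity (suc m) with parity m
... | even q = odd q
... | odd q  = even (suc q)

-- Pigeonhole principle

∷-injective : ∀ {s N} {g : Fin s → Fin N} → Injective _≡_ _≡_ g →
              Injective _≡_ _≡_ (zero ∷ (suc ∘ g))
∷-injective g-inj {zero}  {zero}  eq = ≡.refl
∷-injective g-inj {suc i} {suc j} eq = ≡.cong suc (g-inj (Finₚ.suc-injective eq))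

partition : ∀ {p N} {P : Fin N → Set p} → Decidable P →
            ∃₂ λ s t → Σ (Fin s → Fin N) λ g → Σ (Fin t → Fin N) λ h →
              Injective _≡_ _≡_ g × Injective _≡_ _≡_ h ×
              (∀ i → P (g i)) × (∀ i → ¬ P (h i)) × N ≤ s + t
partition {N = zero} P? = 0 , 0 , id , id , id , id , (λ ()) , (λ ()) , z≤n
partition {N = suc N} P? with partition (P? ∘ suc) | P? zero
... | s , t , g , h , g-inj , h-inj , Pg , ¬Ph , N≤ | yes p₀ =
  suc s , t , zero ∷ (suc ∘ g) , suc ∘ h ,
  ∷-injective g-inj , (h-inj ∘ Finₚ.suc-injective) ,
  (λ { zero → p₀ ; (suc i) → Pg i }) , ¬Ph , s≤s N≤
... | s , t , g , h , g-inj , h-inj , Pg , ¬Ph , N≤ | no ¬p₀ =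
  s , suc t , suc ∘ g , zero ∷ (suc ∘ h) ,
  (g-inj ∘ Finₚ.suc-injective) , ∷-injective h-inj ,
  Pg , (λ { zero → ¬p₀ ; (suc i) → ¬Ph i }) ,
  ≡.subst (suc N ≤_) (≡.sym (ℕₚ.+-suc s t)) (s≤s N≤)

-- Induction on the number of values: split off the fibre of the top value, apply the induction
-- hypothesis to the rest, and keep the larger of the two fibres.
large-fibre : ∀ {N} K (f : Fin N → ℕ) → (∀ i → f i < K) →
              ∃₂ λ W s → Σ (Fin s → Fin N) λ g →
                Injective _≡_ _≡_ g × (∀ i → f (g i) ≡ W) × N ≤ s * K
large-fibre {zero}  zero f f<K = 0 , 0 , (λ ()) , (λ { {()} }) , (λ ()) , z≤n
large-fibre {suc N} zero f f<K = contradiction (f<K zero) λ ()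
large-fibre {N} (suc K) f f<K
  with partition (λ i → f i ℕₚ.≟ K)
... | s , t , g , h , g-inj , h-inj , fg≡K , fh≢K , N≤
  with large-fibre K (f ∘ h) (λ i → ℕₚ.≤∧≢⇒< (s≤s⁻¹ (f<K (h i))) (fh≢K i))
... | W , s′ , g′ , g′-inj , fg′≡W , t≤ with s′ ≤? s
... | yes s′≤s = K , s , g , g-inj , fg≡K , (begin
        N              ≤⟨ N≤ ⟩
        s + t          ≤⟨ ℕₚ.+-monoʳ-≤ s t≤ ⟩
        s + s′ * K     ≤⟨ ℕₚ.+-monoʳ-≤ s (ℕₚ.*-monoˡ-≤ K s′≤s) ⟩
        s + s * K      ≡⟨ ℕₚ.*-suc s K ⟨
        s * suc K      ∎)
  where open ℕₚ.≤-Reasoning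
... | no s′≰s = W , s′ , h ∘ g′ , (g′-inj ∘ h-inj) , fg′≡W , (begin
        N              ≤⟨ N≤ ⟩
        s + t          ≤⟨ ℕₚ.+-mono-≤ (ℕₚ.≰⇒≥ s′≰s) t≤ ⟩
        s′ + s′ * K    ≡⟨ ℕₚ.*-suc s′ K ⟨
        s′ * suc K     ∎)
  where open ℕₚ.≤-Reasoning

-- Stands in for the search for a nonzero entry in a column, which cannot be decided over `F`.
¬¬-all⊎counterexample : ∀ {p n} (P : Fin n → Set p) → ¬ ¬ ((∀ i → P i) ⊎ ∃[ i ] ¬ P i)
¬¬-all⊎counterexample {n = zero}  P k = k (inj₁ λ ())
¬¬-all⊎counterexample {n = suc n} P k = ¬¬-excluded-middle λ where
  (no ¬p₀) → k (inj₂ (zero , ¬p₀))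
  (yes p₀) → ¬¬-all⊎counterexample (P ∘ suc) λ where
    (inj₁ all)      → k (inj₁ λ { zero → p₀ ; (suc i) → all i })
    (inj₂ (i , ¬p)) → k (inj₂ (suc i , ¬p))

-- Words over Fin n, encoded in Fin (n ^ q)

head : ∀ {n q} → Fin (n ^ suc q) → Fin n
head {n} {q} p = proj₁ (remQuot {n} (n ^ q) p)

tail : ∀ {n q} → Fin (n ^ suc q) → Fin (n ^ q)
tail {n} {q} p = proj₂ (remQuot {n} (n ^ q) p)

head-tail-injective : ∀ {n} q {p p′ : Fin (n ^ suc q)} →
                      head {n} {q} p ≡ head {n} {q} p′ → tail {n} {q} p ≡ tail {n} {q} p′ → p ≡ p′
head-tail-injective {n} q {p} {p′} h t =
  ≡.trans (≡.sym (Finₚ.combine-remQuot {n} (n ^ q) p))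
    (≡.trans (≡.cong₂ combine h t) (Finₚ.combine-remQuot {n} (n ^ q) p′))

weight : ∀ {n} → (Fin n → ℕ) → ∀ q → Fin (n ^ q) → ℕ
weight w zero    p = 0
weight w (suc q) p = w (head {q = q} p) + weight w q (tail {q = q} p)

weight-≤ : ∀ {n D} {w : Fin n → ℕ} → (∀ i → w i ≤ D) → ∀ q p → weight w q p ≤ q * D
weight-≤ w≤D zero    p = z≤n
weight-≤ w≤D (suc q) p = ℕₚ.+-mono-≤ (w≤D _) (weight-≤ w≤D q _)

-- Strict convexity in additive form. Both halves survive concatenation of words, so a condition on
-- letters passes to all powers.
Balanced : ∀ {a} {A : Set a} → (A → ℕ) → A → A → A → Set a
Balanced w i j k = w i + w i ≤ w j + w k × (w j + w k ≤ w i + w i → i ≡ j × i ≡ k)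

Balanced-zero : ∀ {n} (w : Fin n → ℕ) i j k → Balanced (weight w 0) i j k
Balanced-zero w zero zero zero = z≤n , λ _ → ≡.refl , ≡.refl

+-≤-equality : ∀ {x y x′ y′} → x ≤ y → x′ ≤ y′ → y + y′ ≤ x + x′ → y ≤ x × y′ ≤ x′
+-≤-equality {x} {y} {x′} {y′} x≤y x′≤y′ h =
  ℕₚ.+-cancelʳ-≤ y′ y x (ℕₚ.≤-trans h (ℕₚ.+-monoʳ-≤ x x′≤y′)) ,
  ℕₚ.+-cancelˡ-≤ y y′ x′ (ℕₚ.≤-trans h (ℕₚ.+-monoˡ-≤ x′ x≤y))

-- The inequalities for head and tail add up. Since neither can compensate for slack in the other,
-- equality in the sum forces equality in both.
Balanced-suc : ∀ {n} (w : Fin n → ℕ) q i j k →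
               Balanced w (head {q = q} i) (head {q = q} j) (head {q = q} k) →
               Balanced (weight w q) (tail {q = q} i) (tail {q = q} j) (tail {q = q} k) →
               Balanced (weight w (suc q)) i j k
Balanced-suc w q i j k (le , eq) (le′ , eq′) =
  ≡.subst₂ _≤_ lhs rhs (ℕₚ.+-mono-≤ le le′) ,
  λ ge →
    let (ge₁ , ge₂) = +-≤-equality le le′ (≡.subst₂ _≤_ (≡.sym rhs) (≡.sym lhs) ge)
        (hj , hk) = eq ge₁
        (tj , tk) = eq′ ge₂
    in head-tail-injective q hj tj , head-tail-injective q hk tk
  where
  interchange : ∀ a b c d → (a + b) + (c + d) ≡ (a + c) + (b + d)
  interchange = solve-∀
  hd = w ∘ head {q = q}
  tl = weight w q ∘ tail {q = q}
  lhs : (hd i + hd i) + (tl i + tl i) ≡ (hd i + tl i) + (hd i + tl i)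
  lhs = interchange (hd i) (hd i) (tl i) (tl i)
  rhs : (hd j + hd k) + (tl j + tl k) ≡ (hd j + tl j) + (hd k + tl k)
  rhs = interchange (hd j) (hd k) (tl j) (tl k)

module _ {c ℓ : Level} (F : CommutativeRing c ℓ) where
  open CommutativeRing F
    renaming (_+_ to _⊕_; _*_ to _·_; -_ to ⊝_)
    hiding (zero)
  open import Algebra.Properties.Ring ring using (-‿distribˡ-*)
  open import Algebra.Properties.CommutativeSemigroup *-commutativeSemigroup
    using () renaming (interchange to ·-interchange)
  import Algebra.Properties.Semiring.Sum semiring as Sum
  open import Relation.Binary.Reasoning.Setoid setoid

  -- Finite sums

  ∑≈sum : ∀ n (f : Fin n → Carrier) → ∑ F f ≈ Sum.sum f
  ∑≈sum zero    f = refl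
  ∑≈sum (suc n) f = +-congˡ (∑≈sum n (f ∘ suc))

  ∑-cong : ∀ n {f g : Fin n → Carrier} → (∀ i → f i ≈ g i) → ∑ F f ≈ ∑ F g
  ∑-cong zero    f≈g = refl
  ∑-cong (suc n) f≈g = +-cong (f≈g zero) (∑-cong n (f≈g ∘ suc))

  ∑-zero : ∀ n {f : Fin n → Carrier} → (∀ i → f i ≈ 0#) → ∑ F f ≈ 0#
  ∑-zero zero    f≈0 = refl
  ∑-zero (suc n) f≈0 = trans (+-cong (f≈0 zero) (∑-zero n (f≈0 ∘ suc))) (+-identityˡ 0#)

  ∑-distrib-⊕ : ∀ n (f g : Fin n → Carrier) → ∑ F (λ i → f i ⊕ g i) ≈ ∑ F f ⊕ ∑ F g
  ∑-distrib-⊕ n f g = trans (∑≈sum n _)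
    (trans (Sum.∑-distrib-+ f g) (sym (+-cong (∑≈sum n f) (∑≈sum n g))))

  ·-distribˡ-∑ : ∀ n x (f : Fin n → Carrier) → x · ∑ F f ≈ ∑ F (λ i → x · f i)
  ·-distribˡ-∑ n x f = trans (*-congˡ (∑≈sum n f)) (trans (Sum.*-distribˡ-sum x f) (sym (∑≈sum n _)))

  ·-distribʳ-∑ : ∀ n x (f : Fin n → Carrier) → ∑ F f · x ≈ ∑ F (λ i → f i · x)
  ·-distribʳ-∑ n x f = trans (*-congʳ (∑≈sum n f)) (trans (Sum.*-distribʳ-sum x f) (sym (∑≈sum n _)))

  ∑-remove : ∀ {n} (i : Fin (suc n)) (f : Fin (suc n) → Carrier) → ∑ F f ≈ f i ⊕ ∑ F (f ∘ punchIn i)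
  ∑-remove {n} i f = trans (∑≈sum (suc n) f)
    (trans (Sum.sum-remove {i = i} f) (+-congˡ (sym (∑≈sum n (f ∘ punchIn i)))))

  ∑-·-∑ : ∀ m n (f : Fin m → Carrier) (g : Fin n → Carrier) →
          ∑ F (λ i → ∑ F (λ j → f i · g j)) ≈ ∑ F f · ∑ F g
  ∑-·-∑ m n f g = trans (∑-cong m (λ i → sym (·-distribˡ-∑ n (f i) g))) (sym (·-distribʳ-∑ m (∑ F g) f))

  ∑-↑ : ∀ m n (f : Fin (m + n) → Carrier) → ∑ F f ≈ ∑ F (f ∘ (_↑ˡ n)) ⊕ ∑ F (f ∘ (m ↑ʳ_))
  ∑-↑ zero    n f = sym (+-identityˡ _)
  ∑-↑ (suc m) n f = trans (+-congˡ (∑-↑ m n (f ∘ suc))) (sym (+-assoc _ _ _))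

  ∑-combine : ∀ m n (f : Fin (m * n) → Carrier) →
              ∑ F f ≈ ∑ F {m} (λ i → ∑ F {n} (λ j → f (combine i j)))
  ∑-combine zero    n f = refl
  ∑-combine (suc m) n f = trans (∑-↑ n (m * n) f) (+-congˡ (∑-combine m n (f ∘ (n ↑ʳ_))))

  ∑-remQuot : ∀ m n (f : Fin m → Fin n → Carrier) →
              ∑ F {m * n} (λ p → uncurry f (remQuot {m} n p)) ≈ ∑ F (λ i → ∑ F (f i))
  ∑-remQuot m n f = trans (∑-combine m n _)
    (∑-cong m λ i → ∑-cong n λ j → reflexive (≡.cong (uncurry f) (Finₚ.remQuot-combine i j)))

  basis : ∀ {n} → Fin n → Fin n → Carrier
  basis zero    zero    = 1#
  basis zero    (suc j) = 0#
  basis (suc i) zero    = 0#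
  basis (suc i) (suc j) = basis i j

  ∑-basis : ∀ {n} (i : Fin n) (f : Fin n → Carrier) → ∑ F (λ j → basis i j · f j) ≈ f i
  ∑-basis {suc n} zero    f = trans (+-cong (*-identityˡ _) (∑-zero n (λ j → zeroˡ (f (suc j))))) (+-identityʳ _)
  ∑-basis {suc n} (suc i) f = trans (+-cong (zeroˡ _) (∑-basis i (f ∘ suc))) (+-identityˡ _)

  ∑-scaled-basis : ∀ {n} x (i : Fin n) (f : Fin n → Carrier) →
                   ∑ F (λ j → x · basis i j · f j) ≈ x · f i
  ∑-scaled-basis {n} x i f = begin
    ∑ F (λ j → x · basis i j · f j)    ≈⟨ ∑-cong n (λ j → *-assoc x (basis i j) (f j)) ⟩
    ∑ F (λ j → x · (basis i j · f j))  ≈⟨ ·-distribˡ-∑ n x (λ j → basis i j · f j) ⟨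
    x · ∑ F (λ j → basis i j · f j)    ≈⟨ *-congˡ (∑-basis i f) ⟩
    x · f i                            ∎

  -- Row reduction

  comb : ∀ {n m} → (Fin n → Carrier) → (Fin n → Fin m → Carrier) → Fin m → Carrier
  comb μ M q = ∑ F (λ i → μ i · M i q)

  comb-zero : ∀ {n m} (M : Fin n → Fin m → Carrier) μ q → (∀ i → M i q ≈ 0#) → comb μ M q ≈ 0#
  comb-zero {n} M μ q Mq≈0 = ∑-zero n λ i → trans (*-congˡ (Mq≈0 i)) (zeroʳ (μ i))

  -- The vectors `rows i` are the new basis of the first leg, in terms of the rows of `M`.
  -- Distinctness of the pivots replaces the usual increasing order.
  record Echelon {n m} (M : Fin n → Fin m → Carrier) : Set (c ⊔ ℓ) where
    field
      rows            : Fin n → Fin n → Carrier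
      pivot           : Fin n → Fin m
      pivot-injective : Injective _≡_ _≡_ pivot
      at-pivot        : ∀ i → comb (rows i) M (pivot i) ≈ 1#
      before-pivot    : ∀ i q → toℕ q < toℕ (pivot i) → comb (rows i) M q ≈ 0#

  module Elimination {n m} (M : Fin (suc n) → Fin m → Carrier) (i₀ : Fin (suc n)) (f : Fin n → Carrier) where

    reduced : Fin n → Fin m → Carrier
    reduced j q = M (punchIn i₀ j) q ⊕ (⊝ f j) · M i₀ q

    -- The coefficient inserted at `i₀` collects the multiples of row `i₀` subtracted in `reduced`,
    -- so combinations of reduced rows become combinations of rows of `M`.
    lift : (Fin n → Carrier) → Fin (suc n) → Carrier
    lift μ = insertAt μ i₀ (∑ F (λ j → μ j · ⊝ f j))

    comb-lift : ∀ μ q → comb (lift μ) M q ≈ comb μ reduced q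
    comb-lift μ q = begin
      comb (lift μ) M q
        ≈⟨ ∑-remove i₀ (λ i → lift μ i · M i q) ⟩
      lift μ i₀ · M i₀ q ⊕ ∑ F (λ j → lift μ (punchIn i₀ j) · M (punchIn i₀ j) q)
        ≈⟨ +-cong (*-congʳ (reflexive (insertAt-lookup μ i₀ _)))
                  (∑-cong n λ j → *-congʳ (reflexive (insertAt-punchIn μ i₀ _ j))) ⟩
      ∑ F (λ j → μ j · ⊝ f j) · M i₀ q ⊕ ∑ F (λ j → μ j · M (punchIn i₀ j) q)
        ≈⟨ +-comm _ _ ⟩
      ∑ F (λ j → μ j · M (punchIn i₀ j) q) ⊕ ∑ F (λ j → μ j · ⊝ f j) · M i₀ q
        ≈⟨ +-congˡ (·-distribʳ-∑ n (M i₀ q) (λ j → μ j · ⊝ f j)) ⟩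
      ∑ F (λ j → μ j · M (punchIn i₀ j) q) ⊕ ∑ F (λ j → μ j · ⊝ f j · M i₀ q)
        ≈⟨ ∑-distrib-⊕ n (λ j → μ j · M (punchIn i₀ j) q) (λ j → μ j · ⊝ f j · M i₀ q) ⟨
      ∑ F (λ j → μ j · M (punchIn i₀ j) q ⊕ μ j · ⊝ f j · M i₀ q)
        ≈⟨ ∑-cong n (λ j → trans (+-congˡ (*-assoc (μ j) (⊝ f j) (M i₀ q))) (sym (distribˡ (μ j) _ _))) ⟩
      comb μ reduced q ∎

    lift-punchIn : ∀ μ j → lift μ (punchIn i₀ j) ≡ μ j
    lift-punchIn μ j = insertAt-punchIn μ i₀ _ j

  dropZeroColumn : ∀ {n m} (M : Fin n → Fin (suc m) → Carrier) → (∀ i → M i zero ≈ 0#) →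
                   FullRowRank F M → FullRowRank F (λ i → M i ∘ suc)
  dropZeroColumn M M₀≈0 full μ vanish = full μ λ where
    zero    → comb-zero M μ zero M₀≈0
    (suc q) → vanish q

  -- Gaussian elimination by induction on the columns: a zero first column is dropped, and a nonzero
  -- entry in it serves as pivot to clear the others.
  echelon : IsField F → ∀ {n} m (M : Fin n → Fin m → Carrier) → FullRowRank F M → ¬ ¬ Echelon M
  echelon isField {zero}  zero M full k = k record
    { rows = λ () ; pivot = λ () ; pivot-injective = λ { {()} } ; at-pivot = λ () ; before-pivot = λ () }
  echelon isField {suc n} zero M full k =
    -- Without columns the all-ones combination vanishes vacuously, so full row rank would give
    -- `1# ≈ 0#`.
    IsField.nontrivial isField (sym (full (λ _ → 1#) (λ ()) zero))
  echelon isField {n} (suc m) M full k = ¬¬-all⊎counterexample (λ i → M i zero ≈ 0#) λ where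
      (inj₁ M₀≈0)         → echelon isField m (λ i → M i ∘ suc) (dropZeroColumn M M₀≈0 full) (k ∘ extend M₀≈0)
      (inj₂ (i₀ , Mi₀≉0)) → eliminate M full k i₀ Mi₀≉0
    where
    extend : (∀ i → M i zero ≈ 0#) → Echelon (λ i → M i ∘ suc) → Echelon M
    extend M₀≈0 E = record
      { rows = rows
      ; pivot = suc ∘ pivot
      ; pivot-injective = pivot-injective ∘ Finₚ.suc-injective
      ; at-pivot = at-pivot
      ; before-pivot = λ where
          i zero    _         → comb-zero M (rows i) zero M₀≈0
          i (suc q) (s≤s q<c) → before-pivot i q q<c
      }
      where open Echelon E

    eliminate : ∀ {n} (M : Fin n → Fin (suc m) → Carrier) → FullRowRank F M → ¬ Echelon M →
                ∀ i₀ → ¬ ¬ (M i₀ zero ≈ 0#)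
    eliminate {suc n} M full k i₀ Mi₀≉0 =
      echelon isField m (λ j → reduced j ∘ suc)
        (dropZeroColumn reduced reduced₀≈0 reduced-full) (k ∘ extend′)
      where
      y = proj₁ (IsField.inverse isField (M i₀ zero) Mi₀≉0)
      My≈1 = proj₂ (IsField.inverse isField (M i₀ zero) Mi₀≉0)

      -- This multiple of row `i₀` clears column `zero`, as `y` is the inverse of the pivot entry.
      open Elimination M i₀ (λ j → M (punchIn i₀ j) zero · y)

      reduced₀≈0 : ∀ j → reduced j zero ≈ 0#
      reduced₀≈0 j = begin
        x ⊕ (⊝ (x · y)) · M i₀ zero  ≈⟨ +-congˡ (-‿distribˡ-* _ _) ⟨
        x ⊕ ⊝ (x · y · M i₀ zero)    ≈⟨ +-congˡ (-‿cong (trans (*-assoc _ _ _) (*-congˡ (trans (*-comm _ _) My≈1)))) ⟩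
        x ⊕ ⊝ (x · 1#)               ≈⟨ +-congˡ (-‿cong (*-identityʳ x)) ⟩
        x ⊕ ⊝ x                      ≈⟨ -‿inverseʳ x ⟩
        0#                           ∎
        where x = M (punchIn i₀ j) zero

      reduced-full : FullRowRank F reduced
      reduced-full μ vanish j = trans (reflexive (≡.sym (lift-punchIn μ j)))
        (full (lift μ) (λ q → trans (comb-lift μ q) (vanish q)) (punchIn i₀ j))

      extend′ : Echelon (λ j → reduced j ∘ suc) → Echelon M
      extend′ E = record
        { rows = (λ i → y · basis i₀ i) ∷ (lift ∘ rows)
        ; pivot = zero ∷ (suc ∘ pivot)
        ; pivot-injective = ∷-injective pivot-injective
        ; at-pivot = λ where
            zero    → trans (∑-scaled-basis y i₀ (λ i → M i zero)) (trans (*-comm _ _) My≈1)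
            (suc j) → trans (comb-lift (rows j) _) (at-pivot j)
        ; before-pivot = λ where
            (suc j) zero    _         → trans (comb-lift (rows j) zero)
                                          (comb-zero reduced (rows j) zero reduced₀≈0)
            (suc j) (suc q) (s≤s q<c) → trans (comb-lift (rows j) (suc q)) (before-pivot j q q<c)
        }
        where open Echelon E

  -- Tensors as trilinear forms

  -- By definition these are the entries of `apply3`, so a restriction to a unit tensor amounts to
  -- families of vectors with prescribed values of this form.
  ev : ∀ {n} → Tensor F n → (u v w : Fin n → Carrier) → Carrier
  ev T u v w = ∑ F (λ i → ∑ F (λ j → ∑ F (λ k → u i · v j · w k · T i j k)))

  ev-basis : ∀ {n} (T : Tensor F n) u x y → ev T u (basis x) (basis y) ≈ ∑ F (λ i → u i · T i x y)
  ev-basis {n} T u x y = ∑-cong n λ i →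
    trans (∑-cong n λ j → ∑-scaled-basis (u i · basis x j) y (T i j))
          (∑-scaled-basis (u i) x (λ j → T i j y))

  infixr 7 _⊠_

  _⊠_ : ∀ {m n} → (Fin m → Carrier) → (Fin n → Carrier) → Fin (m * n) → Carrier
  _⊠_ {m} {n} u v p = u (proj₁ (remQuot {m} n p)) · v (proj₂ (remQuot {m} n p))

  ∑-⊠ : ∀ {m n} (u : Fin m → Carrier) (v : Fin n → Carrier) → ∑ F (u ⊠ v) ≈ ∑ F u · ∑ F v
  ∑-⊠ {m} {n} u v = trans (∑-remQuot m n (λ i j → u i · v j)) (∑-·-∑ m n u v)

  -- Each summand regroups into an `S` part times a `T` part, after which the sums over pair indices
  -- factor one leg at a time.
  ev-kron : ∀ {m n} (S : Tensor F m) (T : Tensor F n) u u′ v v′ w w′ →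
            ev (kron F S T) (u ⊠ u′) (v ⊠ v′) (w ⊠ w′) ≈ ev S u v w · ev T u′ v′ w′
  ev-kron {m} {n} S T u u′ v v′ w w′ =
    trans (∑-cong (m * n) λ p →
      trans (∑-cong (m * n) λ q →
        trans (∑-cong (m * n) λ r → regroup _ _ _ _ _ _ _ _)
              (∑-⊠ (λ k → S³ (fst p) (fst q) k) (λ k → T³ (snd p) (snd q) k)))
            (∑-⊠ (λ j → ∑ F (S³ (fst p) j)) (λ j → ∑ F (T³ (snd p) j))))
          (∑-⊠ (λ i → ∑ F (λ j → ∑ F (S³ i j))) (λ i → ∑ F (λ j → ∑ F (T³ i j))))
    where
    fst : Fin (m * n) → Fin m
    fst p = proj₁ (remQuot {m} n p)
    snd : Fin (m * n) → Fin n
    snd p = proj₂ (remQuot {m} n p)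
    S³ = λ i j k → u i · v j · w k · S i j k
    T³ = λ i j k → u′ i · v′ j · w′ k · T i j k
    regroup : ∀ a a′ b b′ c c′ d d′ →
              a · a′ · (b · b′) · (c · c′) · (d · d′) ≈ a · b · c · d · (a′ · b′ · c′ · d′)
    regroup a a′ b b′ c c′ d d′ =
      trans (*-congʳ (trans (*-congʳ (·-interchange a a′ b b′)) (·-interchange (a · b) (a′ · b′) c c′)))
            (·-interchange (a · b · c) (a′ · b′ · c′) d d′)

  -- Words as product vectors in even Kronecker powers

  Leg : ℕ → ℕ → Set c
  Leg n N = Fin n → Fin N → Carrier

  -- Each letter occupies two tensor factors, `U` on the first and `U′` on the second, whence the
  -- exponent `q * 2`.
  wordLeg : ∀ {n N} → Leg n N → Leg n N → ∀ q → Leg (n ^ q) (N ^ (q * 2))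
  wordLeg U U′ zero    p = λ _ → 1#
  wordLeg U U′ (suc q) p = U (head {q = q} p) ⊠ U′ (head {q = q} p) ⊠ wordLeg U U′ q (tail {q = q} p)

  module Words {n N} (T : Tensor F N) (U U′ V V′ W W′ : Leg n N) (w : Fin n → ℕ) where

    letter : Fin n → Fin n → Fin n → Carrier
    letter i j k = ev T (U i) (V j) (W k) · ev T (U′ i) (V′ j) (W′ k)

    word : ∀ q (i j k : Fin (n ^ q)) → Carrier
    word q i j k = ev (kronPow F (q * 2) T) (wordLeg U U′ q i) (wordLeg V V′ q j) (wordLeg W W′ q k)

    word-zero : ∀ i j k → word 0 i j k ≈ 1#
    word-zero _ _ _ = trans (+-identityʳ _) (trans (+-identityʳ _) (trans (+-identityʳ _)
      (trans (*-identityʳ _) (trans (*-identityʳ _) (*-identityʳ _)))))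

    word-suc : ∀ q i j k → word (suc q) i j k ≈
               letter (head {q = q} i) (head {q = q} j) (head {q = q} k) ·
               word q (tail {q = q} i) (tail {q = q} j) (tail {q = q} k)
    word-suc q i j k =
      trans (ev-kron T (kron F T Tᵐ) (U i₀) _ (V j₀) _ (W k₀) _)
        (trans (*-congˡ (ev-kron T Tᵐ (U′ i₀) (wordLeg U U′ q (tail {q = q} i))
                                      (V′ j₀) (wordLeg V V′ q (tail {q = q} j))
                                      (W′ k₀) (wordLeg W W′ q (tail {q = q} k))))
               (sym (*-assoc _ _ _)))
      where
      Tᵐ = kronPow F (q * 2) T
      i₀ = head {q = q} i
      j₀ = head {q = q} j
      k₀ = head {q = q} k

    module _ (letter-diagonal : ∀ i → letter i i i ≈ 1#)
             (letter-support : ∀ i j k → letter i j k ≈ 0# ⊎ Balanced w i j k) where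

      word-diagonal : ∀ q i → word q i i i ≈ 1#
      word-diagonal zero    i = word-zero i i i
      word-diagonal (suc q) i = trans (word-suc q i i i)
        (trans (*-cong (letter-diagonal _) (word-diagonal q _)) (*-identityˡ 1#))

      -- A disjunction rather than an implication from being nonzero, because vanishing in `F` is
      -- undecidable. One vanishing letter kills the word; otherwise the balances add.
      word-support : ∀ q i j k → word q i j k ≈ 0# ⊎ Balanced (weight w q) i j k
      word-support zero i j k = inj₂ (Balanced-zero w i j k)
      word-support (suc q) i j k
        with letter-support (head {q = q} i) (head {q = q} j) (head {q = q} k)
           | word-support q (tail {q = q} i) (tail {q = q} j) (tail {q = q} k)
      ... | inj₁ ≈0 | _       = inj₁ (trans (word-suc q i j k) (trans (*-congʳ ≈0) (zeroˡ _)))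
      ... | inj₂ _  | inj₁ ≈0 = inj₁ (trans (word-suc q i j k) (trans (*-congˡ ≈0) (zeroʳ _)))
      ... | inj₂ b  | inj₂ b′ = inj₂ (Balanced-suc w q i j k b b′)

      -- Among words of one fixed weight, Balanced forces i = j = k, so the restricted tensor is diagonal.
      restricts : ∀ q {s} (g : Fin s → Fin (n ^ q)) → Injective _≡_ _≡_ g →
                  ∀ {D} → (∀ a → weight w q (g a) ≡ D) → RestrictsToUnit F (kronPow F (q * 2) T) s
      restricts q g g-inj {D} wg≡D =
        wordLeg U U′ q ∘ g , wordLeg V V′ q ∘ g , wordLeg W W′ q ∘ g , entries
        where
        entries : ∀ a b d → word q (g a) (g b) (g d) ≈ unitTensor F _ a b d
        off : ∀ a b d → ¬ (a ≡ b × b ≡ d) → word q (g a) (g b) (g d) ≈ 0#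
        off a b d ¬eq with word-support q (g a) (g b) (g d)
        ... | inj₁ ≈0       = ≈0
        ... | inj₂ (_ , eq) =
          let (ab , ad) = eq (ℕₚ.≤-reflexive (≡.cong₂ _+_ (≡.trans (wg≡D b) (≡.sym (wg≡D a)))
                                                          (≡.trans (wg≡D d) (≡.sym (wg≡D a)))))
          in contradiction (g-inj ab , ≡.trans (≡.sym (g-inj ab)) (g-inj ad)) ¬eq
        entries a b d with a ≟ b | b ≟ d
        ... | yes ≡.refl | yes ≡.refl = word-diagonal q (g a)
        ... | yes _      | no b≢d     = off a b d (b≢d ∘ proj₂)
        ... | no a≢b     | yes _      = off a b d (a≢b ∘ proj₁)
        ... | no a≢b     | no _       = off a b d (a≢b ∘ proj₁)

  -- Contracting `S` to the scalar 1 discards the extra factor; this reduces odd powers to even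
  -- ones.
  restricts-kron : ∀ {m n r} (S : Tensor F m) (T : Tensor F n) {u v w} → ev S u v w ≈ 1# →
                   RestrictsToUnit F T r → RestrictsToUnit F (kron F S T) r
  restricts-kron S T {u} {v} {w} S≈1 (L₁ , L₂ , L₃ , LT≈unit) =
    (u ⊠_) ∘ L₁ , (v ⊠_) ∘ L₂ , (w ⊠_) ∘ L₃ , λ a b d →
      trans (ev-kron S T u (L₁ a) v (L₂ b) w (L₃ d))
        (trans (*-congʳ S≈1) (trans (*-identityˡ _) (LT≈unit a b d)))

  -- Pivots of a symmetric tensor and restrictions of its powers

  module Pivots {n} (T : Tensor F n) (T-swap : ∀ i j k → T i j k ≈ T i k j)
                (E : Echelon (flat₁ F T)) where
    open Echelon E

    x y : Fin n → Fin n
    x i = proj₁ (remQuot {n} n (pivot i))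
    y i = proj₂ (remQuot {n} n (pivot i))

    pivot≡ : ∀ i → combine (x i) (y i) ≡ pivot i
    pivot≡ i = Finₚ.combine-remQuot {n} n (pivot i)

    ev-rows : ∀ i j k → ev T (rows i) (basis j) (basis k) ≈ comb (rows i) (flat₁ F T) (combine j k)
    ev-rows i j k = trans (ev-basis T (rows i) j k) (∑-cong n λ l →
      *-congˡ (reflexive (≡.cong (uncurry (T l)) (≡.sym (Finₚ.remQuot-combine j k)))))

    -- Symmetry enters here: the second copy, with legs 2 and 3 exchanged, is read off the same
    -- reduced slice as the first.
    ev-rows-swap : ∀ i j k → ev T (rows i) (basis k) (basis j) ≈ comb (rows i) (flat₁ F T) (combine j k)
    ev-rows-swap i j k = trans (ev-basis T (rows i) k j)
      (trans (∑-cong n λ l → *-congˡ (T-swap l k j))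
        (trans (sym (ev-basis T (rows i) j k)) (ev-rows i j k)))

    open Words T rows rows (basis ∘ x) (basis ∘ y) (basis ∘ y) (basis ∘ x) (toℕ ∘ pivot)

    comb-pivot : ∀ i → comb (rows i) (flat₁ F T) (combine (x i) (y i)) ≈ 1#
    comb-pivot i = trans (reflexive (≡.cong (comb (rows i) (flat₁ F T)) (pivot≡ i))) (at-pivot i)

    ev-pivot : ∀ i → ev T (rows i) (basis (x i)) (basis (y i)) ≈ 1#
    ev-pivot i = trans (ev-rows i (x i) (y i)) (comb-pivot i)

    diagonal : ∀ i → letter i i i ≈ 1#
    diagonal i = trans (*-cong (ev-pivot i) (trans (ev-rows-swap i (x i) (y i)) (comb-pivot i)))
                       (*-identityˡ 1#)

    -- Positions are `n x + y`, so exchanging the second coordinates of two pivots preserves the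
    -- sum.
    combine-exchange : ∀ j k → toℕ (combine (x j) (y k)) + toℕ (combine (x k) (y j)) ≡
                               toℕ (pivot j) + toℕ (pivot k)
    combine-exchange j k = ≡.trans
      (≡.cong₂ _+_ (Finₚ.toℕ-combine (x j) (y k)) (Finₚ.toℕ-combine (x k) (y j)))
      (≡.trans (lemma (n * toℕ (x j)) (toℕ (y k)) (n * toℕ (x k)) (toℕ (y j)))
      (≡.cong₂ _+_ (toℕ-pivot j) (toℕ-pivot k)))
      where
      lemma : ∀ a b c d → (a + b) + (c + d) ≡ (a + d) + (c + b)
      lemma = solve-∀
      toℕ-pivot : ∀ i → n * toℕ (x i) + toℕ (y i) ≡ toℕ (pivot i)
      toℕ-pivot i = ≡.trans (≡.sym (Finₚ.toℕ-combine (x i) (y i))) (≡.cong toℕ (pivot≡ i))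

    -- Equality of the sums puts both mixed positions `(x j , y k)` and `(x k , y j)` at the pivot
    -- of `i`. Then `j` and `k` share that pivot, and pivots are distinct.
    pivots-balanced : ∀ i j k → toℕ (pivot i) ≤ toℕ (combine (x j) (y k)) →
                      toℕ (pivot i) ≤ toℕ (combine (x k) (y j)) → Balanced (toℕ ∘ pivot) i j k
    pivots-balanced i j k le₁ le₂ =
      ≡.subst (toℕ (pivot i) + toℕ (pivot i) ≤_) (combine-exchange j k) (ℕₚ.+-mono-≤ le₁ le₂) ,
      λ ge →
        let (ge₁ , ge₂) = +-≤-equality le₁ le₂
              (≡.subst (_≤ toℕ (pivot i) + toℕ (pivot i)) (≡.sym (combine-exchange j k)) ge)
            (xj , yk) = position le₁ ge₁
            (xk , yj) = position le₂ ge₂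
        in same-pivot xj yj , same-pivot xk yk
      where
      position : ∀ {p q} → toℕ (pivot i) ≤ toℕ (combine p q) → toℕ (combine p q) ≤ toℕ (pivot i) →
                 x i ≡ p × y i ≡ q
      position {p} {q} le ge = Finₚ.combine-injective (x i) (y i) p q
        (≡.trans (pivot≡ i) (Finₚ.toℕ-injective (ℕₚ.≤-antisym le ge)))
      same-pivot : ∀ {l} → x i ≡ x l → y i ≡ y l → i ≡ l
      same-pivot {l} xi≡xl yi≡yl = pivot-injective
        (≡.trans (≡.sym (pivot≡ i)) (≡.trans (≡.cong₂ combine xi≡xl yi≡yl) (pivot≡ l)))

    support : ∀ i j k → letter i j k ≈ 0# ⊎ Balanced (toℕ ∘ pivot) i j k
    support i j k with toℕ (pivot i) ≤? toℕ (combine (x j) (y k))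
                     | toℕ (pivot i) ≤? toℕ (combine (x k) (y j))
    ... | no ≰₁   | _       = inj₁ (trans (*-congʳ (trans (ev-rows i (x j) (y k))
                                (before-pivot i _ (ℕₚ.≰⇒> ≰₁)))) (zeroˡ _))
    ... | yes _   | no ≰₂   = inj₁ (trans (*-congˡ (trans (ev-rows-swap i (x k) (y j))
                                (before-pivot i _ (ℕₚ.≰⇒> ≰₂)))) (zeroʳ _))
    ... | yes le₁ | yes le₂ = inj₂ (pivots-balanced i j k le₁ le₂)

    even-power : ∀ q → ∃[ s ] RestrictsToUnit F (kronPow F (q * 2) T) s × n ^ q ≤ s * (q * (n * n) + 1)
    even-power q =
      -- Weights lie between 0 and `q n²`, which makes `q n² + 1` possible values.
      let (_ , s , g , g-inj , wg≡D , size) = large-fibre (q * (n * n) + 1) (weight (toℕ ∘ pivot) q)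
            (λ p → ≡.subst (suc (weight (toℕ ∘ pivot) q p) ≤_) (ℕₚ.+-comm 1 (q * (n * n)))
              (s≤s (weight-≤ (λ i → ℕₚ.<⇒≤ (Finₚ.toℕ<n (pivot i))) q p)))
      in s , restricts diagonal support q g g-inj wg≡D , size

    odd-power : Fin n → ∀ q → ∃[ s ] RestrictsToUnit F (kronPow F (suc (q * 2)) T) s ×
                                     n ^ q ≤ s * (q * (n * n) + 1)
    odd-power i q =
      let (s , R , size) = even-power q
      in s , restricts-kron T (kronPow F (q * 2) T) (ev-pivot i) R , size

-- The limit is expressed through rationals: `a/b` is below `√n` when `a² < n b²`, and the
-- conclusion says that `Q^(1/m) ≥ a/b` for all large `m`.
theorem5p16 : ∀ {c ℓ} (F : CommutativeRing c ℓ) → IsField F →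
    (n : ℕ) (T : Tensor F n) → Symmetric F T → Concise F T →
    (a b : ℕ) → a * a < n * (b * b) →
    ∃[ m₀ ] (∀ m → m₀ ≤ m → ∀ r → IsSubrank F (kronPow F m T) r → a ^ m ≤ r * b ^ m)
theorem5p16 F isField n T sym-T (full , _) zero b _ =
  -- Starting at 1 avoids `0 ^ 0 = 1`.
  1 , λ { (suc m) _ r _ → z≤n }
theorem5p16 F isField n T sym-T (full , _) a@(suc _) zero a²<0 =
  contradiction (≡.subst (a * a <_) (ℕₚ.*-zeroʳ n) a²<0) λ ()
theorem5p16 F isField n@(suc _) T sym-T (full , _) a@(suc _) b@(suc _) a²<nb² =
  suc (q₀ * 2) , λ m m₀≤m r subrank → decidable-stable (a ^ m ≤? r * b ^ m)
    (¬¬-map (bound m m₀≤m r subrank) (echelon F isField (n * n) (flat₁ F T) full))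
  where
  open ℕₚ.≤-Reasoning
  -- The threshold of `power-bound`, raised by one to give `1 ≤ q` as well.
  q₀ = suc (2 * (a * a * (a * a)) * ((n * n + 1) * a))

  a·aᵐ≤ : ∀ q s → q₀ ≤ q → n ^ q ≤ s * (q * (n * n) + 1) → a * a ^ (q * 2) ≤ s * b ^ (q * 2)
  a·aᵐ≤ q s q₀≤q = power-bound a b n q s a²<nb² (ℕₚ.<⇒≤ q₀≤q) (ℕₚ.≤-trans (s≤s z≤n) q₀≤q)

  bound : ∀ m → suc (q₀ * 2) ≤ m → ∀ r → IsSubrank F (kronPow F m T) r →
          Echelon F (flat₁ F T) → a ^ m ≤ r * b ^ m
  bound m m₀≤m r (_ , maximal) E with parity m
  ... | even q =
    let (s , R , size) = Pivots.even-power F T (λ i j k → proj₁ (sym-T i j k)) E q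
    in begin
      -- For even exponents the spare factor `a` is simply given away.
      a ^ (q * 2)        ≤⟨ ℕₚ.m≤n*m (a ^ (q * 2)) a ⟩
      a * a ^ (q * 2)    ≤⟨ a·aᵐ≤ q s (ℕₚ.*-cancelʳ-≤ q₀ q 2 (ℕₚ.<⇒≤ m₀≤m)) size ⟩
      s * b ^ (q * 2)    ≤⟨ ℕₚ.*-monoˡ-≤ (b ^ (q * 2)) (maximal s R) ⟩
      r * b ^ (q * 2)    ∎
  ... | odd q =
    let (s , R , size) = Pivots.odd-power F T (λ i j k → proj₁ (sym-T i j k)) E zero q
    in begin
      -- For odd exponents the spare factor `a` is the last factor of `a ^ m`, since the extra copy
      -- of `T` adds nothing to `s`.
      a * a ^ (q * 2)          ≤⟨ a·aᵐ≤ q s (ℕₚ.*-cancelʳ-≤ q₀ q 2 (s≤s⁻¹ m₀≤m)) size ⟩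
      s * b ^ (q * 2)          ≤⟨ ℕₚ.*-mono-≤ (maximal s R) (ℕₚ.m≤n*m (b ^ (q * 2)) b) ⟩
      r * (b * b ^ (q * 2))    ∎
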